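{- Let $\Gamma$ be a Neumaier graph with vertex set $V$ and parameters $(n,k,\lambda;a,c)$. Let $C\subset V$ be a regular clique with nexus $a$, let $e\in C$ be an arbitrary vertex, and let $S$ be the set of neighbours of $e$ in $\Gamma$. Then: (i) The induced subgraph on $S\setminus C$ is regular. Moreover, if the number of neighbours in $S\setminus C$ of a vertex $x\in V\setminus(S\cup\{e\})$ is independent of the choice of $x$, then $\{\{e\},\,C\setminus\{e\},\,S\setminus C,\,V\setminus(S\cup\{e\})\}$ is an equitable partition of $\Gamma$. (ii) If $\Gamma$ is strongly regular, then the number of neighbours in $S\setminus C$ of a vertex $x\in V\setminus(S\cup\{e\})$ is independent of the choice of $x$. (iii) If $\Gamma$ is vertex-transitive, then $\Gamma$ has diameter $2$. Moreover, in this case $\Gamma$ is strongly regular if and only if the number of neighbours in $S\setminus C$ of a vertex $x\in V\setminus(S\cup\{e\})$ is independent of the choice of $x$.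
   Context: All graphs are finite, simple, undirected and connected. A graph is edge-regular with parameters $(n,k,\lambda)$ if it has $n$ vertices, is $k$-regular, and any two adjacent vertices have exactly $\lambda$ common neighbours. A clique $C$ is a regular clique with nexus $a$ if every vertex not in $C$ has exactly $a$ neighbours in $C$. A Neumaier graph is a non-complete edge-regular graph containing a regular clique; in a Neumaier graph all regular cliques have the same size $c$ and nexus $a$, and the graph has parameters $(n,k,\lambda;a,c)$ if it is edge-regular with parameters $(n,k,\lambda)$ and contains a regular clique of size $c$ with nexus $a$. A strongly regular graph with parameters $(n,k,\lambda,\mu)$ is a non-complete connected $k$-regular graph on $n$ vertices in which two adjacent vertices have exactly $\lambda$ common neighbours and two non-adjacent vertices have exactly $\mu$ common neighbours. A partition $\{V_1,\dots,V_m\}$ of the vertex set is equitable if for all $i,j$ the number of neighbours in $V_j$ of a vertex $x\in V_i$ depends only on $i,j$. -}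

module Defs where

open import Level using (0ℓ)
open import Data.Fin.Base using (Fin; zero; suc)
open import Data.Fin.Permutation using (Permutation′; _⟨$⟩ʳ_)
open import Data.Fin.Subset using (Subset; inside; outside; _∈_; _∉_; _∩_; ∣_∣; Nonempty)
open import Data.Nat.Base using (ℕ; zero; suc; _≤_)
open import Data.Product using (Σ-syntax; ∃-syntax; _×_; ∃!)
open import Data.Vec.Base using (Vec; []; _∷_; lookup; tabulate)
open import Function.Bundles using (_⇔_)
open import Relation.Binary.Core using (Rel)
open import Relation.Binary.Definitions using (Decidable; Symmetric)
open import Relation.Binary.PropositionalEquality using (_≡_; _≢_)
open import Relation.Nullary using (¬_; does)

-- A finite simple undirected graph with vertex set Fin n.  Connectedness is
-- not built in, because induced subgraphs need not be connected; it is part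
-- of IsNeumaier and IsStronglyRegular.
record Graph (n : ℕ) : Set₁ where
  infix 4 _~_ _~?_
  field
    _~_      : Rel (Fin n) 0ℓ
    _~?_     : Decidable _~_
    ~-sym    : Symmetric _~_
    ~-irrefl : ∀ {x} → ¬ (x ~ x)

  neighbours : Fin n → Subset n
  neighbours x = tabulate (λ y → does (x ~? y))

  neighboursIn : Subset n → Fin n → ℕ
  neighboursIn T x = ∣ neighbours x ∩ T ∣

  degree : Fin n → ℕ
  degree x = ∣ neighbours x ∣

  commonNeighbours : Fin n → Fin n → ℕ
  commonNeighbours x y = ∣ neighbours x ∩ neighbours y ∣

  data Walk : Fin n → Fin n → ℕ → Set where
    here : ∀ {x} → Walk x x zero
    step : ∀ {x y z m} → x ~ y → Walk y z m → Walk x z (suc m)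

open Graph public using (neighbours; neighboursIn)

-- The vertices in T, listed in increasing order.
element : ∀ {n} (T : Subset n) → Fin ∣ T ∣ → Fin n
element (inside  ∷ T) zero    = zero
element (inside  ∷ T) (suc i) = suc (element T i)
element (outside ∷ T) i       = suc (element T i)

-- The induced subgraph on T, with the vertices in T renumbered by Fin ∣ T ∣.
induced : ∀ {n} → Graph n → (T : Subset n) → Graph ∣ T ∣
induced Γ T = record
  { _~_      = λ i j → element T i ~ element T j
  ; _~?_     = λ i j → element T i ~? element T j
  ; ~-sym    = ~-sym
  ; ~-irrefl = ~-irrefl
  }
  where open Graph Γ

-- The value of f at a vertex of T is independent of the choice of that vertex.
ConstantOn : ∀ {n} → Subset n → (Fin n → ℕ) → Set
ConstantOn T f = ∀ {x y} → x ∈ T → y ∈ T → f x ≡ f y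

module _ {n : ℕ} (Γ : Graph n) where
  open Graph Γ hiding (neighbours; neighboursIn)

  Connected : Set
  Connected = ∀ x y → ∃[ m ] Walk x y m

  Complete : Set
  Complete = ∀ x y → x ≢ y → x ~ y

  Distance : Fin n → Fin n → ℕ → Set
  Distance x y d = Walk x y d × (∀ m → Walk x y m → d ≤ m)

  Diameter : ℕ → Set
  Diameter d = (∀ x y → ∃[ m ] Distance x y m × m ≤ d)
             × (∃[ x ] ∃[ y ] Distance x y d)

  IsRegular : ℕ → Set
  IsRegular k = ∀ x → degree x ≡ k

  Regular : Set
  Regular = ∃[ k ] IsRegular k

  record IsEdgeRegular (k ℓ : ℕ) : Set where
    field
      regular  : IsRegular k
      adjacent : ∀ x y → x ~ y → commonNeighbours x y ≡ ℓ

  record IsRegularClique (a : ℕ) (C : Subset n) : Set where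
    field
      nonempty : Nonempty C
      clique   : ∀ x y → x ∈ C → y ∈ C → x ≢ y → x ~ y
      nexus    : ∀ x → x ∉ C → neighboursIn Γ C x ≡ a

  -- Neumaier graph with parameters (n, k, ℓ; a, c).
  record IsNeumaier (k ℓ a c : ℕ) : Set where
    field
      connected     : Connected
      notComplete   : ¬ Complete
      edgeRegular   : IsEdgeRegular k ℓ
      regularClique : Σ[ C ∈ Subset n ] IsRegularClique a C × ∣ C ∣ ≡ c

  -- Strongly regular graph with parameters (n, k, ℓ, μ).
  record IsStronglyRegular (k ℓ μ : ℕ) : Set where
    field
      connected   : Connected
      notComplete : ¬ Complete
      edgeRegular : IsEdgeRegular k ℓ
      nonadjacent : ∀ x y → x ≢ y → ¬ (x ~ y) → commonNeighbours x y ≡ μ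

  StronglyRegular : Set
  StronglyRegular = ∃[ k ] ∃[ ℓ ] ∃[ μ ] IsStronglyRegular k ℓ μ

  IsAutomorphism : Permutation′ n → Set
  IsAutomorphism σ = ∀ x y → x ~ y ⇔ (σ ⟨$⟩ʳ x) ~ (σ ⟨$⟩ʳ y)

  VertexTransitive : Set
  VertexTransitive =
    ∀ x y → Σ[ σ ∈ Permutation′ n ] IsAutomorphism σ × σ ⟨$⟩ʳ x ≡ y

  -- Every part is nonempty and every vertex lies in exactly one part.
  record IsEquitablePartition {m : ℕ} (P : Vec (Subset n) m) : Set where
    field
      nonempty  : ∀ i → Nonempty (lookup P i)
      partition : ∀ x → ∃! _≡_ (λ i → x ∈ lookup P i)
      equitable : ∀ i j → ConstantOn (lookup P i) (neighboursIn Γ (lookup P j))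

{-# OPTIONS --safe #-}

-- For every vertex x the numbers of neighbours of x in C and in S split as
--   ∣N x ∩ C∣ = ∣N x ∩ {e}∣ + ∣N x ∩ (C - e)∣,
--   ∣N x ∩ S∣ = ∣N x ∩ (C - e)∣ + ∣N x ∩ (S ─ C)∣.
-- On each of C - e, S ─ C and R both ∣N x ∩ C∣ and ∣N x ∩ {e}∣ are constant, and
-- ∣N x ∩ S∣, the number of common neighbours of x and e, is ℓ on the first two
-- parts.  Hence all columns of the quotient matrix are constant there, while on R
-- independence is equivalent to ∣N x ∩ S∣ being constant, i.e. to the strongly
-- regular condition at e, which automorphisms carry to every vertex.  As a > 0, a
-- vertex outside C has a neighbour in C, so e has eccentricity 2.

module Submission where

open import Defs
open import Data.Bool.Base using (if_then_else_)
open import Data.Fin.Base using (Fin; zero; suc)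
open import Data.Fin.Patterns using (0F; 1F; 2F; 3F)
open import Data.Fin.Permutation using (Permutation′; _⟨$⟩ʳ_; _⟨$⟩ˡ_; inverseʳ)
open import Data.Fin.Properties using () renaming (_≟_ to _≟ᶠ_)
open import Data.Fin.Subset using (Subset; inside; outside; _∈_; _∉_; _⊆_; _∩_; _∪_; _─_; _-_; ∁; ⁅_⁆; ∣_∣; Nonempty; Empty)
open import Data.Fin.Subset.Properties
open import Data.Nat.Base using (ℕ; zero; suc; _+_; _∸_; _≤_; _<_; z≤n; s≤s)
open import Data.Nat.Properties using (+-0-commutativeMonoid; +-suc; +-cancelˡ-≡; suc-injective; <⇒≱; ≤-reflexive; ≤-refl; module ≤-Reasoning)
open import Data.Product.Base using (Σ-syntax; ∃-syntax; _×_; _,_; proj₁; proj₂)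
open import Data.Sum.Base using (inj₁; inj₂; [_,_]; fromInj₁)
open import Data.Vec.Base using (Vec; []; _∷_; lookup; tabulate; here; there)
open import Data.Vec.Properties using (lookup∘tabulate; tabulate-cong; []=⇒lookup; lookup⇒[]=)
open import Function.Base using (_∘_; case_of_)
open import Function.Bundles using (_⇔_; mk⇔; Equivalence; Injection)
open import Function.Properties.Inverse using (↔⇒↣)
open import Relation.Binary.PropositionalEquality using (_≡_; _≢_; refl; sym; trans; cong; cong₂; subst; module ≡-Reasoning)
open import Relation.Nullary using (¬_; yes; no; does; contradiction)
open import Relation.Nullary.Decidable using (dec-true; does-⇔; decidable-stable)
open import Algebra.Properties.CommutativeMonoid.Sum +-0-commutativeMonoid using (sum; sum-permute; sum-cong-≗)

open Equivalence using (to; from)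

private
  variable
    n : ℕ
    p q : Subset n

-- Set difference and cardinality of subsets.

p─q≡p∩∁q : ∀ (p q : Subset n) → p ─ q ≡ p ∩ ∁ q
p─q≡p∩∁q []            []            = refl
p─q≡p∩∁q (inside  ∷ p) (inside  ∷ q) = cong (outside ∷_) (p─q≡p∩∁q p q)
p─q≡p∩∁q (inside  ∷ p) (outside ∷ q) = cong (inside ∷_) (p─q≡p∩∁q p q)
p─q≡p∩∁q (outside ∷ p) (inside  ∷ q) = cong (outside ∷_) (p─q≡p∩∁q p q)
p─q≡p∩∁q (outside ∷ p) (outside ∷ q) = cong (outside ∷_) (p─q≡p∩∁q p q)

x∈p─q⇒x∉q : ∀ (p q : Subset n) {x} → x ∈ p ─ q → x ∉ q
x∈p─q⇒x∉q p q {x} x∈ =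
  x∈∁p⇒x∉p (p∩q⊆q p (∁ q) (subst (x ∈_) (p─q≡p∩∁q p q) x∈))

x∈p-y⇒x≢y : ∀ (p : Subset n) {x y} → x ∈ p - y → x ≢ y
x∈p-y⇒x≢y p x∈ = x∉⁅y⁆⇒x≢y (x∈p─q⇒x∉q p ⁅ _ ⁆ x∈)

-- Every count below is split by this identity, with `p` specialised to a set of neighbours.
∣p∣≡∣p∩q∣+∣p∩∁q∣ : ∀ (p q : Subset n) → ∣ p ∣ ≡ ∣ p ∩ q ∣ + ∣ p ∩ ∁ q ∣
∣p∣≡∣p∩q∣+∣p∩∁q∣ []            []            = refl
∣p∣≡∣p∩q∣+∣p∩∁q∣ (inside  ∷ p) (inside  ∷ q) = cong suc (∣p∣≡∣p∩q∣+∣p∩∁q∣ p q)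
∣p∣≡∣p∩q∣+∣p∩∁q∣ (inside  ∷ p) (outside ∷ q) =
  trans (cong suc (∣p∣≡∣p∩q∣+∣p∩∁q∣ p q)) (sym (+-suc ∣ p ∩ q ∣ ∣ p ∩ ∁ q ∣))
∣p∣≡∣p∩q∣+∣p∩∁q∣ (outside ∷ p) (inside  ∷ q) = ∣p∣≡∣p∩q∣+∣p∩∁q∣ p q
∣p∣≡∣p∩q∣+∣p∩∁q∣ (outside ∷ p) (outside ∷ q) = ∣p∣≡∣p∩q∣+∣p∩∁q∣ p q

x∈p⇒p∩⁅x⁆≡⁅x⁆ : ∀ {x} → x ∈ p → p ∩ ⁅ x ⁆ ≡ ⁅ x ⁆
x∈p⇒p∩⁅x⁆≡⁅x⁆ {p = p} {x} x∈p = ⊆-antisym (p∩q⊆q p ⁅ x ⁆)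
  (λ y∈ → x∈p∩q⁺ (subst (_∈ p) (sym (x∈⁅y⁆⇒x≡y x y∈)) x∈p , y∈))

∣p∣≡1+∣p-x∣ : ∀ {x} → x ∈ p → ∣ p ∣ ≡ suc ∣ p - x ∣
∣p∣≡1+∣p-x∣ {p = p} {x} x∈p = begin
  ∣ p ∣                             ≡⟨ ∣p∣≡∣p∩q∣+∣p∩∁q∣ p ⁅ x ⁆ ⟩
  ∣ p ∩ ⁅ x ⁆ ∣ + ∣ p ∩ ∁ ⁅ x ⁆ ∣   ≡⟨ cong₂ _+_ (trans (cong ∣_∣ (x∈p⇒p∩⁅x⁆≡⁅x⁆ x∈p)) (∣⁅x⁆∣≡1 x))
                                                 (cong ∣_∣ (sym (p─q≡p∩∁q p ⁅ x ⁆))) ⟩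
  suc ∣ p - x ∣                     ∎
  where open ≡-Reasoning

Empty⇒∣p∣≡0 : {p : Subset n} → Empty p → ∣ p ∣ ≡ 0
Empty⇒∣p∣≡0 {n} ∅ = trans (cong ∣_∣ (Empty-unique ∅)) (∣⊥∣≡0 n)

-- Nonemptiness of a subset is decidable, so refuting emptiness is enough to produce a witness.
∣p∣≢0⇒Nonempty : ∣ p ∣ ≢ 0 → Nonempty p
∣p∣≢0⇒Nonempty {p = p} ∣p∣≢0 = decidable-stable (nonempty? p) (∣p∣≢0 ∘ Empty⇒∣p∣≡0)

Nonempty⇒∣p∣≢0 : Nonempty p → ∣ p ∣ ≢ 0
Nonempty⇒∣p∣≢0 (x , x∈p) ∣p∣≡0 = case trans (sym (∣p∣≡1+∣p-x∣ x∈p)) ∣p∣≡0 of λ ()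

∣p∣≡sum : ∀ (p : Subset n) → ∣ p ∣ ≡ sum (λ x → if does (x ∈? p) then 1 else 0)
∣p∣≡sum []            = refl
∣p∣≡sum (inside  ∷ p) = cong suc (∣p∣≡sum p)
∣p∣≡sum (outside ∷ p) = ∣p∣≡sum p

-- As a sum of 0-1 indicators over all vertices, a cardinality inherits the invariance of finite
-- sums under reindexing.
∣∣-permute : (σ : Permutation′ n) → (∀ x → x ∈ p ⇔ σ ⟨$⟩ʳ x ∈ q) → ∣ p ∣ ≡ ∣ q ∣
∣∣-permute {p = p} {q = q} σ p⇔q = begin
  ∣ p ∣                                                     ≡⟨ ∣p∣≡sum p ⟩
  sum (λ x → if does (x ∈? p) then 1 else 0)                ≡⟨ sum-cong-≗ (λ x → cong (if_then 1 else 0) (does-⇔ (p⇔q x) (x ∈? p) (σ ⟨$⟩ʳ x ∈? q))) ⟩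
  sum (λ x → if does (σ ⟨$⟩ʳ x ∈? q) then 1 else 0)         ≡⟨ sum-permute (λ x → if does (x ∈? q) then 1 else 0) σ ⟨
  sum (λ x → if does (x ∈? q) then 1 else 0)                ≡⟨ ∣p∣≡sum q ⟨
  ∣ q ∣                                                     ∎
  where open ≡-Reasoning

-- Renumbered subsets, as used by induced subgraphs.

element∈ : ∀ (T : Subset n) i → element T i ∈ T
element∈ (inside  ∷ T) zero    = here
element∈ (inside  ∷ T) (suc i) = there (element∈ T i)
element∈ (outside ∷ T) i       = there (element∈ T i)

-- The left side restricts the indicator of `p` to `T` in the new numbering; it turns degrees in an
-- induced subgraph into neighbour counts in `Γ`.
∣restrict∣≡∣p∩T∣ : ∀ (p T : Subset n) → ∣ tabulate (lookup p ∘ element T) ∣ ≡ ∣ p ∩ T ∣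
∣restrict∣≡∣p∩T∣ []            []            = refl
∣restrict∣≡∣p∩T∣ (inside  ∷ p) (inside  ∷ T) = cong suc (∣restrict∣≡∣p∩T∣ p T)
∣restrict∣≡∣p∩T∣ (inside  ∷ p) (outside ∷ T) = ∣restrict∣≡∣p∩T∣ p T
∣restrict∣≡∣p∩T∣ (outside ∷ p) (inside  ∷ T) = ∣restrict∣≡∣p∩T∣ p T
∣restrict∣≡∣p∩T∣ (outside ∷ p) (outside ∷ T) = ∣restrict∣≡∣p∩T∣ p T

-- Calculus of functions constant on a subset.

module _ {T : Subset n} {f g h : Fin n → ℕ} (h≗f+g : ∀ x → h x ≡ f x + g x) where

  constantOn-+ : ConstantOn T f → ConstantOn T g → ConstantOn T h
  constantOn-+ cf cg {x} {y} x∈ y∈ = begin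
    h x        ≡⟨ h≗f+g x ⟩
    f x + g x  ≡⟨ cong₂ _+_ (cf x∈ y∈) (cg x∈ y∈) ⟩
    f y + g y  ≡⟨ h≗f+g y ⟨
    h y        ∎
    where open ≡-Reasoning

  constantOn-cancelˡ : ConstantOn T h → ConstantOn T f → ConstantOn T g
  constantOn-cancelˡ ch cf {x} {y} x∈ y∈ = +-cancelˡ-≡ (f x) _ _ (begin
    f x + g x  ≡⟨ h≗f+g x ⟨
    h x        ≡⟨ ch x∈ y∈ ⟩
    h y        ≡⟨ h≗f+g y ⟩
    f y + g y  ≡⟨ cong (_+ g y) (cf y∈ x∈) ⟩
    f x + g y  ∎)
    where open ≡-Reasoning

constantly : ∀ {T : Subset n} {f m} → (∀ x → x ∈ T → f x ≡ m) → ConstantOn T f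
constantly eq x∈ y∈ = trans (eq _ x∈) (sym (eq _ y∈))

constantOn-⁅⁆ : ∀ {e : Fin n} f → ConstantOn ⁅ e ⁆ f
constantOn-⁅⁆ {e = e} f x∈ y∈ = cong f (trans (x∈⁅y⁆⇒x≡y e x∈) (sym (x∈⁅y⁆⇒x≡y e y∈)))

-- Neighbour counts, walks and automorphisms in an arbitrary graph.

module _ (Γ : Graph n) where
  open Graph Γ hiding (neighbours; neighboursIn)

  private
    N   = neighbours Γ
    nIn = neighboursIn Γ

  ∈neighbours⁺ : ∀ {x y} → x ~ y → y ∈ N x
  ∈neighbours⁺ {x} {y} x~y =
    lookup⇒[]= y _ (trans (lookup∘tabulate _ y) (dec-true (x ~? y) x~y))

  ∈neighbours⁻ : ∀ {x y} → y ∈ N x → x ~ y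
  ∈neighbours⁻ {x} {y} y∈ with x ~? y | trans (sym (lookup∘tabulate (λ z → does (x ~? z)) y)) ([]=⇒lookup y∈)
  ... | yes x~y | _  = x~y
  ... | no  _   | ()

  x∉neighbours[x] : ∀ {x} → x ∉ N x
  x∉neighbours[x] = ~-irrefl ∘ ∈neighbours⁻

  neighboursIn-split : ∀ p q x → nIn p x ≡ nIn (p ∩ q) x + nIn (p ─ q) x
  neighboursIn-split p q x = begin
    ∣ N x ∩ p ∣                                ≡⟨ ∣p∣≡∣p∩q∣+∣p∩∁q∣ (N x ∩ p) q ⟩
    ∣ (N x ∩ p) ∩ q ∣ + ∣ (N x ∩ p) ∩ ∁ q ∣    ≡⟨ cong₂ (λ u v → ∣ u ∣ + ∣ v ∣) (∩-assoc (N x) p q)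
                                                    (trans (∩-assoc (N x) p (∁ q)) (cong (N x ∩_) (sym (p─q≡p∩∁q p q)))) ⟩
    nIn (p ∩ q) x + nIn (p ─ q) x              ∎
    where open ≡-Reasoning

  neighboursIn-⁅⁆-adjacent : ∀ {x y} → x ~ y → nIn ⁅ y ⁆ x ≡ 1
  neighboursIn-⁅⁆-adjacent {x} {y} x~y =
    trans (cong ∣_∣ (x∈p⇒p∩⁅x⁆≡⁅x⁆ (∈neighbours⁺ x~y))) (∣⁅x⁆∣≡1 y)

  neighboursIn-⁅⁆-nonadjacent : ∀ {x y} → ¬ x ~ y → nIn ⁅ y ⁆ x ≡ 0
  neighboursIn-⁅⁆-nonadjacent {x} {y} x≁y = Empty⇒∣p∣≡0 λ (z , z∈) →
    let z∈N , z∈⁅y⁆ = x∈p∩q⁻ (N x) ⁅ y ⁆ z∈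
    in x≁y (subst (x ~_) (x∈⁅y⁆⇒x≡y y z∈⁅y⁆) (∈neighbours⁻ z∈N))

  degree-induced : ∀ T i → Graph.degree (induced Γ T) i ≡ nIn T (element T i)
  degree-induced T i = trans
    (cong ∣_∣ (tabulate-cong λ j → sym (lookup∘tabulate (λ y → does (element T i ~? y)) (element T j))))
    (∣restrict∣≡∣p∩T∣ (N (element T i)) T)

  constantOn⇒induced-regular : ∀ {T} → Nonempty T → ConstantOn T (nIn T) → Regular (induced Γ T)
  constantOn⇒induced-regular {T} (t , t∈T) const =
    nIn T t , λ i → trans (degree-induced T i) (const (element∈ T i) t∈T)

  -- Follow the walk to its first vertex outside `C`; the edge entering that vertex is the one
  -- sought.
  walk-crosses : ∀ {C x y m} → x ∈ C → y ∉ C → Walk x y m →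
                 ∃[ u ] ∃[ w ] u ∈ C × w ∉ C × u ~ w
  walk-crosses x∈C y∉C here = contradiction x∈C y∉C
  walk-crosses {C} x∈C y∉C (step {x} {z} x~z walk) with z ∈? C
  ... | yes z∈C = walk-crosses z∈C y∉C walk
  ... | no  z∉C = x , z , x∈C , z∉C , x~z

  -- A vertex adjacent to all others has degree n ∸ 1, and then so does every vertex.
  regular⇒∃nonneighbour : ∀ {k} → IsRegular Γ k → ¬ Complete Γ →
                          ∀ x → Nonempty (∁ (N x ∪ ⁅ x ⁆))
  regular⇒∃nonneighbour {k} regular notComplete x =
    decidable-stable (nonempty? _) λ ∅ → notComplete (complete ∅)
    where
    complete : Empty (∁ (N x ∪ ⁅ x ⁆)) → Complete Γ
    complete ∅ y z y≢z = decidable-stable (y ~? z) λ y≁z →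
      contradiction (≤-reflexive (trans (regular x) (sym (regular y)))) (<⇒≱ (∣Ny∣<∣Nx∣ y≁z))
      where
      ∁⁅x⁆⊆Nx : ∁ ⁅ x ⁆ ⊆ N x
      ∁⁅x⁆⊆Nx {w} w∈ = fromInj₁ (λ w∈⁅x⁆ → contradiction w∈⁅x⁆ (x∈∁p⇒x∉p w∈))
        (x∈p∪q⁻ (N x) ⁅ x ⁆ (x∉∁p⇒x∈p (λ w∈∁ → ∅ (w , w∈∁))))
      Ny⊆∁⁅y⁆ : N y ⊆ ∁ ⁅ y ⁆
      Ny⊆∁⁅y⁆ w∈ = x∉p⇒x∈∁p (x≢y⇒x∉⁅y⁆ λ { refl → x∉neighbours[x] w∈ })
      ∣Ny∣<∣Nx∣ : ¬ y ~ z → ∣ N y ∣ < ∣ N x ∣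
      ∣Ny∣<∣Nx∣ y≁z = begin-strict
        ∣ N y ∣         <⟨ p⊂q⇒∣p∣<∣q∣ (Ny⊆∁⁅y⁆ , z , x∉p⇒x∈∁p (x≢y⇒x∉⁅y⁆ (y≢z ∘ sym)) , y≁z ∘ ∈neighbours⁻) ⟩
        ∣ ∁ ⁅ y ⁆ ∣     ≡⟨ ∣∁p∣≡n∸∣p∣ ⁅ y ⁆ ⟩
        n ∸ ∣ ⁅ y ⁆ ∣   ≡⟨ cong (n ∸_) (trans (∣⁅x⁆∣≡1 y) (sym (∣⁅x⁆∣≡1 x))) ⟩
        n ∸ ∣ ⁅ x ⁆ ∣   ≡⟨ ∣∁p∣≡n∸∣p∣ ⁅ x ⁆ ⟨
        ∣ ∁ ⁅ x ⁆ ∣     ≤⟨ p⊆q⇒∣p∣≤∣q∣ ∁⁅x⁆⊆Nx ⟩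
        ∣ N x ∣         ∎
        where open ≤-Reasoning

  -- An automorphism maps the common neighbours of a pair bijectively onto those of the image pair.
  commonNeighbours-automorphism : ∀ σ → IsAutomorphism Γ σ → ∀ x y →
    commonNeighbours x y ≡ commonNeighbours (σ ⟨$⟩ʳ x) (σ ⟨$⟩ʳ y)
  commonNeighbours-automorphism σ aut x y = ∣∣-permute σ λ z → mk⇔
    (λ z∈ → let z∈Nx , z∈Ny = x∈p∩q⁻ (N x) (N y) z∈ in
      x∈p∩q⁺ (∈neighbours⁺ (to (aut x z) (∈neighbours⁻ z∈Nx)) , ∈neighbours⁺ (to (aut y z) (∈neighbours⁻ z∈Ny))))
    (λ z∈ → let z∈Nx , z∈Ny = x∈p∩q⁻ (N (σ ⟨$⟩ʳ x)) (N (σ ⟨$⟩ʳ y)) z∈ in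
      x∈p∩q⁺ (∈neighbours⁺ (from (aut x z) (∈neighbours⁻ z∈Nx)) , ∈neighbours⁺ (from (aut y z) (∈neighbours⁻ z∈Ny))))

  -- The two negative hypotheses exclude walks of length 0 and 1.
  distance-2 : ∀ {x y z} → x ≢ y → ¬ x ~ y → x ~ z → z ~ y → Distance Γ x y 2
  distance-2 x≢y x≁y x~z z~y = step x~z (step z~y here) , λ where
    _ here                      → contradiction refl x≢y
    _ (step x~y here)           → contradiction x~y x≁y
    _ (step _ (step _ _))       → s≤s (s≤s z≤n)

  -- The four parts at `e` in a Neumaier graph, and the count identities between them.

  module _ {k ℓ a c} (neumaier : IsNeumaier Γ k ℓ a c)
           {C} (regularClique : IsRegularClique Γ a C) {e} (e∈C : e ∈ C) where
    open IsNeumaier neumaier using (connected; notComplete; edgeRegular)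
    open IsEdgeRegular edgeRegular using (regular; adjacent)
    open IsRegularClique regularClique using (clique; nexus)

    private
      S = N e
      R = ∁ (S ∪ ⁅ e ⁆)

      P : Vec (Subset n) 4
      P = ⁅ e ⁆ ∷ (C - e) ∷ (S ─ C) ∷ R ∷ []

    ∈C-e⁻ : ∀ {x} → x ∈ C - e → x ∈ C × x ≢ e
    ∈C-e⁻ x∈ = p─q⊆p C ⁅ e ⁆ x∈ , x∈p-y⇒x≢y C x∈

    ∈C-e⇒e~ : ∀ {x} → x ∈ C - e → e ~ x
    ∈C-e⇒e~ x∈ = let x∈C , x≢e = ∈C-e⁻ x∈ in clique _ _ e∈C x∈C (x≢e ∘ sym)

    ∈S─C⁻ : ∀ {x} → x ∈ S ─ C → e ~ x × x ∉ C
    ∈S─C⁻ x∈ = ∈neighbours⁻ (p─q⊆p S C x∈) , x∈p─q⇒x∉q S C x∈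

    ∈R⁺ : ∀ {x} → x ≢ e → ¬ e ~ x → x ∈ R
    ∈R⁺ x≢e e≁x = x∉p⇒x∈∁p ([ e≁x ∘ ∈neighbours⁻ , x≢e ∘ x∈⁅y⁆⇒x≡y e ] ∘ x∈p∪q⁻ S ⁅ e ⁆)

    ∈R⁻ : ∀ {x} → x ∈ R → x ≢ e × ¬ e ~ x
    ∈R⁻ x∈ = (λ { refl → x∈∁p⇒x∉p x∈ (x∈p∪q⁺ (inj₂ (x∈⁅x⁆ e))) })
           , (λ e~x → x∈∁p⇒x∉p x∈ (x∈p∪q⁺ (inj₁ (∈neighbours⁺ e~x))))

    R∌C : ∀ {x} → x ∈ R → x ∉ C
    R∌C x∈ x∈C = let x≢e , e≁x = ∈R⁻ x∈ in e≁x (clique _ _ e∈C x∈C (x≢e ∘ sym))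

    -- Because `C` is a clique through `e`, the part `C - e` is common to `C` and `S`; this links
    -- the counts in `C` to those in `S`.
    S∩C≡C-e : S ∩ C ≡ C - e
    S∩C≡C-e = ⊆-antisym
      (λ x∈ → let x∈S , x∈C = x∈p∩q⁻ S C x∈ in
        x∈p∧x≢y⇒x∈p-y x∈C λ { refl → x∉neighbours[x] x∈S })
      (λ x∈ → x∈p∩q⁺ (∈neighbours⁺ (∈C-e⇒e~ x∈) , proj₁ (∈C-e⁻ x∈)))

    S∪e─e≡S : (S ∪ ⁅ e ⁆) ─ ⁅ e ⁆ ≡ S
    S∪e─e≡S = ⊆-antisym
      (λ x∈ → fromInj₁ (λ x∈e → contradiction x∈e (x∈p─q⇒x∉q _ _ x∈))
        (x∈p∪q⁻ S ⁅ e ⁆ (p─q⊆p _ ⁅ e ⁆ x∈)))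
      (λ x∈S → x∈p∧x∉q⇒x∈p─q (x∈p∪q⁺ (inj₁ x∈S)) (x≢y⇒x∉⁅y⁆ λ { refl → x∉neighbours[x] x∈S }))

    neighboursIn-C : ∀ x → nIn C x ≡ nIn ⁅ e ⁆ x + nIn (C - e) x
    neighboursIn-C x = trans (neighboursIn-split C ⁅ e ⁆ x)
      (cong (λ T → nIn T x + nIn (C - e) x) (x∈p⇒p∩⁅x⁆≡⁅x⁆ e∈C))

    neighboursIn-S : ∀ x → nIn S x ≡ nIn (C - e) x + nIn (S ─ C) x
    neighboursIn-S x = trans (neighboursIn-split S C x)
      (cong (λ T → nIn T x + nIn (S ─ C) x) S∩C≡C-e)

    neighboursIn-S∪e : ∀ x → nIn (S ∪ ⁅ e ⁆) x ≡ nIn ⁅ e ⁆ x + nIn S x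
    neighboursIn-S∪e x = trans (neighboursIn-split (S ∪ ⁅ e ⁆) ⁅ e ⁆ x)
      (cong₂ (λ T U → nIn T x + nIn U x) (x∈p⇒p∩⁅x⁆≡⁅x⁆ (q⊆p∪q S ⁅ e ⁆ (x∈⁅x⁆ e))) S∪e─e≡S)

    degree-S∪e : ∀ x → degree x ≡ nIn (S ∪ ⁅ e ⁆) x + nIn R x
    degree-S∪e x = ∣p∣≡∣p∩q∣+∣p∩∁q∣ (N x) (S ∪ ⁅ e ⁆)

    -- Columns of the quotient matrix.

    equitable-columns : ∀ {T} → ConstantOn T (nIn ⁅ e ⁆) → ConstantOn T (nIn C) → ConstantOn T (nIn S) →
                        ∀ j → ConstantOn T (nIn (lookup P j))
    equitable-columns ce cC cS 0F = ce
    equitable-columns ce cC cS 1F = constantOn-cancelˡ neighboursIn-C cC ce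
    equitable-columns ce cC cS 2F = constantOn-cancelˡ neighboursIn-S cS (constantOn-cancelˡ neighboursIn-C cC ce)
    -- The total count is the degree, constant by regularity; subtracting the count in the
    -- complement `S ∪ ⁅ e ⁆` leaves the one in `R`.
    equitable-columns ce cC cS 3F = constantOn-cancelˡ degree-S∪e
      (λ {x} {y} _ _ → trans (regular x) (sym (regular y)))
      (constantOn-+ neighboursIn-S∪e ce cS)

    adjacent⇒constant-e : ∀ {T} → (∀ {x} → x ∈ T → e ~ x) → ConstantOn T (nIn ⁅ e ⁆)
    adjacent⇒constant-e e~ = constantly λ _ x∈ → neighboursIn-⁅⁆-adjacent (~-sym (e~ x∈))

    -- Since `S` is `N e`, the count at `x` is by definition `commonNeighbours x e`, which
    -- edge-regularity fixes as `ℓ`.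
    adjacent⇒constant-S : ∀ {T} → (∀ {x} → x ∈ T → e ~ x) → ConstantOn T (nIn S)
    adjacent⇒constant-S e~ = constantly λ x x∈ → adjacent x e (~-sym (e~ x∈))

    -- Within the clique, `x` is adjacent to exactly `C - x`, so the count is one less than the size
    -- of `C`.
    constant-C : ConstantOn C (nIn C)
    constant-C x∈C y∈C = suc-injective (trans (sym (∣C∣≡1+ x∈C)) (∣C∣≡1+ y∈C))
      where
      ∣C∣≡1+ : ∀ {x} → x ∈ C → ∣ C ∣ ≡ suc (nIn C x)
      ∣C∣≡1+ {x} x∈C = trans (∣p∣≡1+∣p-x∣ x∈C) (cong (suc ∘ ∣_∣) (⊆-antisym
        (λ y∈ → let y∈C = p─q⊆p C ⁅ x ⁆ y∈ in
          x∈p∩q⁺ (∈neighbours⁺ (clique _ _ x∈C y∈C (x∈p-y⇒x≢y C y∈ ∘ sym)) , y∈C))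
        (λ y∈ → let y∈N , y∈C = x∈p∩q⁻ (N x) C y∈ in
          x∈p∧x≢y⇒x∈p-y y∈C λ { refl → x∉neighbours[x] y∈N })))

    columns-C-e : ∀ j → ConstantOn (C - e) (nIn (lookup P j))
    columns-C-e = equitable-columns (adjacent⇒constant-e ∈C-e⇒e~)
      (λ x∈ y∈ → constant-C (proj₁ (∈C-e⁻ x∈)) (proj₁ (∈C-e⁻ y∈)))
      (adjacent⇒constant-S ∈C-e⇒e~)

    columns-S─C : ∀ j → ConstantOn (S ─ C) (nIn (lookup P j))
    columns-S─C = equitable-columns (adjacent⇒constant-e (proj₁ ∘ ∈S─C⁻))
      (constantly λ x x∈ → nexus x (proj₂ (∈S─C⁻ x∈)))
      (adjacent⇒constant-S (proj₁ ∘ ∈S─C⁻))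

    constant-R-e : ConstantOn R (nIn ⁅ e ⁆)
    constant-R-e = constantly λ _ x∈ → neighboursIn-⁅⁆-nonadjacent (proj₂ (∈R⁻ x∈) ∘ ~-sym)

    constant-R-C : ConstantOn R (nIn C)
    constant-R-C = constantly λ x x∈ → nexus x (R∌C x∈)

    columns-R : ConstantOn R (nIn S) → ∀ j → ConstantOn R (nIn (lookup P j))
    columns-R = equitable-columns constant-R-e constant-R-C

    Independent : Set
    Independent = ConstantOn R (nIn (S ─ C))

    -- On `R` the count in `C - e` is constant by the nexus condition; adding it to the count in
    -- `S ─ C` gives the one in `S`.
    independent⇒constant-S : Independent → ConstantOn R (nIn S)
    independent⇒constant-S = constantOn-+ neighboursIn-S
      (constantOn-cancelˡ neighboursIn-C constant-R-C constant-R-e)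

    -- Nonemptiness of the parts.

    R-nonempty : Nonempty R
    R-nonempty = regular⇒∃nonneighbour regular notComplete e

    -- Connectedness gives a walk from `e` to a vertex of `R`, which must leave `C` along some edge.
    crossing : ∃[ u ] ∃[ w ] u ∈ C × w ∉ C × u ~ w
    crossing = let r , r∈R = R-nonempty in
      walk-crosses e∈C (R∌C r∈R) (proj₂ (connected e r))

    -- The nexus is positive: the outer end `w` of the crossing edge has a neighbour in `C`, and all
    -- vertices outside `C` have equally many.
    ∉C⇒∃neighbour∈C : ∀ {x} → x ∉ C → ∃[ z ] z ∈ C × x ~ z
    ∉C⇒∃neighbour∈C {x} x∉C =
      let u , w , u∈C , w∉C , u~w = crossing
          z , z∈ = ∣p∣≢0⇒Nonempty {p = N x ∩ C} λ ∣∣≡0 →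
            Nonempty⇒∣p∣≢0 (u , x∈p∩q⁺ (∈neighbours⁺ (~-sym u~w) , u∈C))
              (trans (nexus w w∉C) (trans (sym (nexus x x∉C)) ∣∣≡0))
          z∈N , z∈C = x∈p∩q⁻ (N x) C z∈
      in z , z∈C , ∈neighbours⁻ z∈N

    -- A vertex of `R` has a neighbour in `C`, and that neighbour is not `e`.
    C-e-nonempty : Nonempty (C - e)
    C-e-nonempty =
      let r , r∈R = R-nonempty
          z , z∈C , r~z = ∉C⇒∃neighbour∈C (R∌C r∈R)
      in z , x∈p∧x≢y⇒x∈p-y z∈C λ z≡e →
           proj₂ (∈R⁻ r∈R) (~-sym (subst (r ~_) z≡e r~z))

    -- If all neighbours of `e` lay in `C`, its degree would be at most the size of `C - e`. The
    -- crossing vertex `u` is adjacent to all of `C - u` and also to `w` outside `C`, so its degree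
    -- would be larger, against regularity.
    S─C-nonempty : Nonempty (S ─ C)
    S─C-nonempty = decidable-stable (nonempty? _) λ ∅ →
      contradiction (≤-reflexive (trans (regular u) (sym (regular e)))) (<⇒≱ (∣S∣<∣Nu∣ ∅))
      where
      u = proj₁ crossing
      w = proj₁ (proj₂ crossing)
      u∈C = proj₁ (proj₂ (proj₂ crossing))
      w∉C = proj₁ (proj₂ (proj₂ (proj₂ crossing)))
      u~w = proj₂ (proj₂ (proj₂ (proj₂ crossing)))
      S⊆C-e : Empty (S ─ C) → S ⊆ C - e
      S⊆C-e ∅ {x} x∈S with x ∈? C
      ... | yes x∈C = subst (x ∈_) S∩C≡C-e (x∈p∩q⁺ (x∈S , x∈C))
      ... | no  x∉C = contradiction (x , x∈p∧x∉q⇒x∈p─q x∈S x∉C) ∅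
      C-u⊂Nu : C - u ⊆ N u
      C-u⊂Nu x∈ = ∈neighbours⁺ (clique _ _ u∈C (p─q⊆p C ⁅ u ⁆ x∈) (x∈p-y⇒x≢y C x∈ ∘ sym))
      ∣S∣<∣Nu∣ : Empty (S ─ C) → ∣ S ∣ < ∣ N u ∣
      ∣S∣<∣Nu∣ ∅ = begin-strict
        ∣ S ∣      ≤⟨ p⊆q⇒∣p∣≤∣q∣ (S⊆C-e ∅) ⟩
        ∣ C - e ∣  ≡⟨ suc-injective (trans (sym (∣p∣≡1+∣p-x∣ e∈C)) (∣p∣≡1+∣p-x∣ u∈C)) ⟩
        ∣ C - u ∣  <⟨ p⊂q⇒∣p∣<∣q∣ (C-u⊂Nu , w , ∈neighbours⁺ u~w , w∉C ∘ p─q⊆p C ⁅ u ⁆) ⟩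
        ∣ N u ∣    ∎
        where open ≤-Reasoning

    -- Regularity on `S ─ C`, the equitable partition, and the strongly regular case.

    induced-S─C-regular : Regular (induced Γ (S ─ C))
    induced-S─C-regular = constantOn⇒induced-regular S─C-nonempty (columns-S─C 2F)

    e∉R : e ∉ R
    e∉R e∈ = proj₁ (∈R⁻ e∈) refl

    equitablePartition : Independent → IsEquitablePartition Γ P
    equitablePartition ind = record
      { nonempty = λ where
          0F → e , x∈⁅x⁆ e
          1F → C-e-nonempty
          2F → S─C-nonempty
          3F → R-nonempty
      -- The tests `x ≡ e`, `x ∈ C` and `e ~ x`, taken in this order, determine the part; membership
      -- in any other part contradicts one of their outcomes.
      ; partition = λ x → case x ≟ᶠ e of λ where
          (yes refl) → 0F , x∈⁅x⁆ e ,
            λ { {0F} _ → refl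
              ; {1F} p → contradiction refl (proj₂ (∈C-e⁻ p))
              ; {2F} p → contradiction e∈C (proj₂ (∈S─C⁻ p))
              ; {3F} p → contradiction p e∉R
              }
          (no x≢e) → case x ∈? C of λ where
            (yes x∈C) → 1F , x∈p∧x≢y⇒x∈p-y x∈C x≢e ,
              λ { {0F} p → contradiction (x∈⁅y⁆⇒x≡y e p) x≢e
                ; {1F} _ → refl
                ; {2F} p → contradiction x∈C (proj₂ (∈S─C⁻ p))
                ; {3F} p → contradiction x∈C (R∌C p)
                }
            (no x∉C) → case e ~? x of λ where
              (yes e~x) → 2F , x∈p∧x∉q⇒x∈p─q (∈neighbours⁺ e~x) x∉C ,
                λ { {0F} p → contradiction (x∈⁅y⁆⇒x≡y e p) x≢e
                  ; {1F} p → contradiction (proj₁ (∈C-e⁻ p)) x∉C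
                  ; {2F} _ → refl
                  ; {3F} p → contradiction e~x (proj₂ (∈R⁻ p))
                  }
              (no e≁x) → 3F , ∈R⁺ x≢e e≁x ,
                λ { {0F} p → contradiction (x∈⁅y⁆⇒x≡y e p) x≢e
                  ; {1F} p → contradiction (proj₁ (∈C-e⁻ p)) x∉C
                  ; {2F} p → contradiction (proj₁ (∈S─C⁻ p)) e≁x
                  ; {3F} _ → refl
                  }
      ; equitable = λ where
          0F j → constantOn-⁅⁆ (nIn (lookup P j))
          1F   → columns-C-e
          2F   → columns-S─C
          3F   → columns-R (independent⇒constant-S ind)
      }

    -- A vertex of `R` is distinct from and nonadjacent to `e`, so its count in `S` is the constant
    -- `μ`; the column of `S ─ C` follows by cancellation.
    stronglyRegular⇒independent : StronglyRegular Γ → Independent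
    stronglyRegular⇒independent (_ , _ , _ , srg) = columns-R
      (constantly λ x x∈ → nonadjacent x e (proj₁ (∈R⁻ x∈)) (proj₂ (∈R⁻ x∈) ∘ ~-sym)) 2F
      where open IsStronglyRegular srg using (nonadjacent)

    -- Vertex-transitive graphs: diameter and strong regularity.

    module _ (transitive : VertexTransitive Γ) where

      -- Reduces any distinct nonadjacent pair to one formed by `e` and a vertex of `R`, where the
      -- information about `C` applies.
      move-to-R : ∀ {x y} → x ≢ y → ¬ x ~ y →
        Σ[ σ ∈ Permutation′ n ] IsAutomorphism Γ σ × σ ⟨$⟩ʳ x ≡ e × σ ⟨$⟩ʳ y ∈ R
      move-to-R {x} {y} x≢y x≁y with transitive x e
      ... | σ , aut , refl = σ , aut , refl , ∈R⁺
        (λ σy≡σx → x≢y (sym (Injection.injective (↔⇒↣ σ) σy≡σx)))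
        (x≁y ∘ from (aut x y))

      nonadjacent⇒distance-2 : ∀ {x y} → x ≢ y → ¬ x ~ y → Distance Γ x y 2
      nonadjacent⇒distance-2 {x} {y} x≢y x≁y with move-to-R x≢y x≁y
      ... | σ , aut , refl , σy∈R =
        -- A neighbour `z` of the image of `y` in `C` differs from `e`, hence is adjacent to `e` as
        -- well; its preimage `z′` is the midpoint sought.
        let z , z∈C , σy~z = ∉C⇒∃neighbour∈C (R∌C σy∈R)
            z≢e : z ≢ e
            z≢e z≡e = proj₂ (∈R⁻ σy∈R) (~-sym (subst (_ ~_) z≡e σy~z))
            z′ = σ ⟨$⟩ˡ z
            σz′≡z = inverseʳ σ
        in distance-2 {z = z′} x≢y x≁y
             (from (aut x z′) (subst (e ~_) (sym σz′≡z) (clique e z e∈C z∈C (z≢e ∘ sym))))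
             (from (aut z′ y) (subst (_~ _) (sym σz′≡z) (~-sym σy~z)))

      diameter-2 : Diameter Γ 2
      diameter-2 = distance≤2 , e , r , nonadjacent⇒distance-2 (r≢e ∘ sym) e≁r
        where
        r = proj₁ R-nonempty
        r≢e = proj₁ (∈R⁻ (proj₂ R-nonempty))
        e≁r = proj₂ (∈R⁻ (proj₂ R-nonempty))
        distance≤2 : ∀ x y → ∃[ m ] Distance Γ x y m × m ≤ 2
        distance≤2 x y with x ≟ᶠ y | x ~? y
        ... | yes refl | _       = 0 , (here , λ _ _ → z≤n) , z≤n
        ... | no  x≢y  | yes x~y = 1 , (step x~y here , λ { _ here → contradiction refl x≢y ; _ (step _ _) → s≤s z≤n }) , s≤s z≤n
        ... | no  x≢y  | no  x≁y = 2 , nonadjacent⇒distance-2 x≢y x≁y , ≤-refl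

      -- The parameter `μ` is read off at one vertex of `R`; constancy on `R` and transport by
      -- automorphisms give the same value at every nonadjacent pair.
      independent⇒stronglyRegular : Independent → StronglyRegular Γ
      independent⇒stronglyRegular ind = k , ℓ , nIn S (proj₁ R-nonempty) , record
        { connected   = connected
        ; notComplete = notComplete
        ; edgeRegular = edgeRegular
        ; nonadjacent = nonadjacent
        }
        where
        nonadjacent : ∀ x y → x ≢ y → ¬ x ~ y → commonNeighbours x y ≡ nIn S (proj₁ R-nonempty)
        nonadjacent x y x≢y x≁y with move-to-R x≢y x≁y
        ... | σ , aut , σx≡e , σy∈R = begin
          commonNeighbours x y                      ≡⟨ commonNeighbours-automorphism σ aut x y ⟩
          commonNeighbours (σ ⟨$⟩ʳ x) (σ ⟨$⟩ʳ y)    ≡⟨ cong (λ z → commonNeighbours z (σ ⟨$⟩ʳ y)) σx≡e ⟩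
          commonNeighbours e (σ ⟨$⟩ʳ y)             ≡⟨ cong ∣_∣ (∩-comm S (N (σ ⟨$⟩ʳ y))) ⟩
          nIn S (σ ⟨$⟩ʳ y)                          ≡⟨ independent⇒constant-S ind σy∈R (proj₂ R-nonempty) ⟩
          nIn S (proj₁ R-nonempty)                  ∎
          where open ≡-Reasoning

theorem3p3 :
    ∀ (n k ℓ a c : ℕ) (Γ : Graph n) → IsNeumaier Γ k ℓ a c →
    ∀ (C : Subset n) → IsRegularClique Γ a C →
    ∀ (e : Fin n) → e ∈ C →
    let S = neighbours Γ e
        R = ∁ (S ∪ ⁅ e ⁆)
        independent = ConstantOn R (neighboursIn Γ (S ─ C))
    in
      (Regular (induced Γ (S ─ C))
        × (independent →
             IsEquitablePartition Γ (⁅ e ⁆ ∷ (C - e) ∷ (S ─ C) ∷ R ∷ [])))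
      × (StronglyRegular Γ → independent)
      × (VertexTransitive Γ →
           Diameter Γ 2 × (StronglyRegular Γ ⇔ independent))
theorem3p3 n k ℓ a c Γ neumaier C regularClique e e∈C =
    (induced-S─C-regular Γ neumaier regularClique e∈C
    , equitablePartition Γ neumaier regularClique e∈C)
  , stronglyRegular⇒independent Γ neumaier regularClique e∈C
  , λ transitive →
      diameter-2 Γ neumaier regularClique e∈C transitive
    , mk⇔ (stronglyRegular⇒independent Γ neumaier regularClique e∈C)
          (independent⇒stronglyRegular Γ neumaier regularClique e∈C transitive)
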